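{- For every integer $n\geq 0$, let $M_n$, $BM_n$, $U_n$, $BU_n$ denote respectively the numbers of $n$-variable Boolean functions that are monotone, balanced and monotone, unate, balanced and unate, and let $\mathrm{nd}\text{ - }M_n$, $\mathrm{nd}\text{ - }BM_n$, $\mathrm{nd}\text{ - }U_n$, $\mathrm{nd}\text{ - }BU_n$ denote the numbers of those among them that are in addition non-degenerate. Then for every $n\geq 0$: \begin{align*} \mathrm{nd}\text{ - }U_n &= 2^n\cdot \mathrm{nd}\text{ - }M_n,\\ \mathrm{nd}\text{ - }BU_n &= 2^n\cdot \mathrm{nd}\text{ - }BM_n,\\ U_n &\leq 2^n\cdot M_n,\\ BU_n &\leq 2^n\cdot BM_n. \end{align*}
   Context: An $n$-variable Boolean function is a map $f:\{0,1\}^n\to\{0,1\}$. It is monotone increasing (resp. decreasing) in the $i$-th variable if $f(x_1,\ldots,x_{i-1},0,x_{i+1},\ldots,x_n)\leq f(x_1,\ldots,x_{i-1},1,x_{i+1},\ldots,x_n)$ (resp. $\geq$) for all $x_1,\ldots,x_{i-1},x_{i+1},\ldots,x_n\in\{0,1\}$. It is unate if for each $i\in\{1,\ldots,n\}$ it is either monotone increasing or monotone decreasing in the $i$-th variable. It is monotone if it is monotone increasing in every variable. It is balanced if it takes the values $0$ and $1$ an equal number of times. It is non-degenerate on the $i$-th variable if there is $\alpha\in\{0,1\}^n$ with $f(\alpha)\neq f(\alpha\oplus \mathbf{e}_i)$, where $\mathbf{e}_i$ is the $n$-bit string with $1$ in position $i$ and $0$ elsewhere and $\oplus$ is bitwise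 XOR; it is non-degenerate if it is non-degenerate on all $n$ variables. Convention for $n=0$: there are exactly two $0$-variable Boolean functions (the constants $0$ and $1$), and both are non-degenerate, monotone (hence unate), and not balanced. -}

module Defs where

open import Data.Bool using (Bool; true; false; _≤_; _xor_; _≟_)
open import Data.Bool.Properties using (_≤?_)
open import Data.Fin using (Fin)
open import Data.Fin.Properties using (all?)
open import Data.List using (List; []; _∷_; length; filter; cartesianProductWith)
open import Data.List.Membership.Propositional using (_∈_; lose)
import Data.List.Membership.Propositional.Properties as Mem
import Data.List.Membership.Setoid.Properties as SetoidMem
open import Data.List.Relation.Unary.All as All using (All; []; _∷_)
open import Data.List.Relation.Unary.AllPairs using ([]; _∷_)
open import Data.List.Relation.Unary.Any as Any using (here; there)
import Data.List.Relation.Unary.Enumerates.Setoid as Enum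
import Data.List.Relation.Unary.Unique.Setoid as SetoidUnique
import Data.List.Relation.Unary.Unique.Setoid.Properties as SetoidUniqueP
open import Data.List.Relation.Unary.Unique.Propositional using (Unique)
import Data.List.Relation.Unary.Unique.Propositional.Properties as UniqueP
open import Data.Nat using (ℕ; zero; suc)
import Data.Nat as ℕ
open import Data.Product using (∃; _,_)
open import Data.Sum using (_⊎_)
open import Data.Vec using (Vec; []; _∷_; _[_]≔_; replicate; zipWith)
import Data.Vec.Properties as VecP
open import Level using (0ℓ)
open import Relation.Binary.Bundles using (Setoid)
open import Relation.Binary.PropositionalEquality
  using (_≡_; _≢_; refl; _→-setoid_)
open import Relation.Nullary using (Dec; _⊎-dec_; ¬?)
open import Relation.Nullary.Decidable using (map′)
open import Relation.Unary using (Pred; Decidable; _∩_)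
open import Relation.Unary.Properties using (_∩?_)

private
  variable
    n : ℕ

-- {0,1}ⁿ, with false for 0 and true for 1.
Input : ℕ → Set
Input n = Vec Bool n

BooleanFunction : ℕ → Set
BooleanFunction n = Input n → Bool

-- x occurs with its i-th coordinate overwritten, so that coordinate of x is
-- irrelevant.
IncreasingIn : Fin n → Pred (BooleanFunction n) 0ℓ
IncreasingIn i f = ∀ x → f (x [ i ]≔ false) ≤ f (x [ i ]≔ true)

DecreasingIn : Fin n → Pred (BooleanFunction n) 0ℓ
DecreasingIn i f = ∀ x → f (x [ i ]≔ true) ≤ f (x [ i ]≔ false)

Unate : Pred (BooleanFunction n) 0ℓ
Unate f = ∀ i → IncreasingIn i f ⊎ DecreasingIn i f

Monotone : Pred (BooleanFunction n) 0ℓ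
Monotone f = ∀ i → IncreasingIn i f

_⊕_ : Input n → Input n → Input n
_⊕_ = zipWith _xor_

e : Fin n → Input n
e i = replicate _ false [ i ]≔ true

NonDegenerateOn : Fin n → Pred (BooleanFunction n) 0ℓ
NonDegenerateOn i f = ∃ λ α → f α ≢ f (α ⊕ e i)

NonDegenerate : Pred (BooleanFunction n) 0ℓ
NonDegenerate f = ∀ i → NonDegenerateOn i f

bits : List Bool
bits = false ∷ true ∷ []

inputs : ∀ n → List (Input n)
inputs zero    = [] ∷ []
inputs (suc n) = cartesianProductWith _∷_ bits (inputs n)

occurrences : BooleanFunction n → Bool → ℕ
occurrences {n} f b = length (filter (λ x → f x ≟ b) (inputs n))

Balanced : Pred (BooleanFunction n) 0ℓ
Balanced f = occurrences f false ≡ occurrences f true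

branch : BooleanFunction n → BooleanFunction n → BooleanFunction (suc n)
branch g h (false ∷ x) = g x
branch g h (true  ∷ x) = h x

-- Each Boolean function exactly once, up to pointwise equality; see
-- functions-enumerates and functions-unique.
functions : ∀ n → List (BooleanFunction n)
functions zero    = (λ _ → false) ∷ (λ _ → true) ∷ []
functions (suc n) = cartesianProductWith branch (functions n) (functions n)

∈-bits : ∀ b → b ∈ bits
∈-bits false = here refl
∈-bits true  = there (here refl)

bits-unique : Unique bits
bits-unique = ((λ ()) ∷ []) ∷ [] ∷ []

∈-inputs : (x : Input n) → x ∈ inputs n
∈-inputs []      = here refl
∈-inputs (b ∷ x) = Mem.∈-cartesianProductWith⁺ _∷_ (∈-bits b) (∈-inputs x)

inputs-unique : ∀ n → Unique (inputs n)
inputs-unique zero    = [] ∷ []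
inputs-unique (suc n) =
  UniqueP.cartesianProductWith⁺ _∷_ VecP.∷-injective bits-unique (inputs-unique n)

functionSetoid : ℕ → Setoid 0ℓ 0ℓ
functionSetoid n = Input n →-setoid Bool

functions-enumerates : ∀ n → Enum.IsEnumeration (functionSetoid n) (functions n)
functions-enumerates zero f with f [] in eq
... | false = here λ { [] → eq }
... | true  = there (here λ { [] → eq })
functions-enumerates (suc n) f =
  SetoidMem.∈-resp-≈ (functionSetoid (suc n)) {functions (suc n)}
    (λ { (false ∷ x) → refl ; (true ∷ x) → refl })
    (SetoidMem.∈-cartesianProductWith⁺
      (functionSetoid n) (functionSetoid n) (functionSetoid (suc n)) {f = branch}
      (λ { p q (false ∷ x) → p x ; p q (true ∷ x) → q x })
      (functions-enumerates n (λ x → f (false ∷ x)))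
      (functions-enumerates n (λ x → f (true ∷ x))))

functions-unique : ∀ n → SetoidUnique.Unique (functionSetoid n) (functions n)
functions-unique zero    = ((λ p → f≢t (p [])) ∷ []) ∷ [] ∷ []
  where
  f≢t : false ≢ true
  f≢t ()
functions-unique (suc n) =
  SetoidUniqueP.cartesianProductWith⁺
    (functionSetoid n) (functionSetoid n) (functionSetoid (suc n)) branch
    (λ p → (λ x → p (false ∷ x)) , (λ x → p (true ∷ x)))
    (functions-unique n) (functions-unique n)

allInputs? : {P : Pred (Input n) 0ℓ} → Decidable P → Dec (∀ x → P x)
allInputs? {n} P? =
  map′ (λ ps x → All.lookup ps (∈-inputs x)) (λ p → All.tabulate λ {x} _ → p x)
    (All.all? P? (inputs n))

anyInput? : {P : Pred (Input n) 0ℓ} → Decidable P → Dec (∃ P)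
anyInput? {n} P? =
  map′ Any.satisfied (λ { (x , p) → lose (∈-inputs x) p })
    (Any.any? P? (inputs n))

increasingIn? : (i : Fin n) → Decidable (IncreasingIn i)
increasingIn? i f = allInputs? λ x → f (x [ i ]≔ false) ≤? f (x [ i ]≔ true)

decreasingIn? : (i : Fin n) → Decidable (DecreasingIn i)
decreasingIn? i f = allInputs? λ x → f (x [ i ]≔ true) ≤? f (x [ i ]≔ false)

unate? : Decidable (Unate {n})
unate? f = all? λ i → increasingIn? i f ⊎-dec decreasingIn? i f

monotone? : Decidable (Monotone {n})
monotone? f = all? λ i → increasingIn? i f

nonDegenerate? : Decidable (NonDegenerate {n})
nonDegenerate? f = all? λ i → anyInput? λ α → ¬? (f α ≟ f (α ⊕ e i))

balanced? : Decidable (Balanced {n})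
balanced? f = occurrences f false ℕ.≟ occurrences f true

count : (P : Pred (BooleanFunction n) 0ℓ) → Decidable P → ℕ
count {n} P P? = length (filter P? (functions n))

M BM U BU nd-M nd-BM nd-U nd-BU : ℕ → ℕ
M     n = count {n} Monotone monotone?
BM    n = count {n} (Balanced ∩ Monotone) (balanced? ∩? monotone?)
U     n = count {n} Unate unate?
BU    n = count {n} (Balanced ∩ Unate) (balanced? ∩? unate?)
nd-M  n = count {n} (NonDegenerate ∩ Monotone) (nonDegenerate? ∩? monotone?)
nd-BM n = count {n} (NonDegenerate ∩ (Balanced ∩ Monotone))
                    (nonDegenerate? ∩? (balanced? ∩? monotone?))
nd-U  n = count {n} (NonDegenerate ∩ Unate) (nonDegenerate? ∩? unate?)
nd-BU n = count {n} (NonDegenerate ∩ (Balanced ∩ Unate))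
                    (nonDegenerate? ∩? (balanced? ∩? unate?))

{-# OPTIONS --safe #-}

-- Translating the input by s, f ↦ (x ↦ f (s ⊕ x)), flips the direction of
-- monotonicity exactly in the variables where s is 1, and preserves balance and
-- non-degeneracy. So the orientation s of a unate function f (s i = 0 where f is
-- increasing, 1 elsewhere) together with the monotone translate of f determines f, which
-- gives the inequalities. A non-degenerate f has only one orientation, so every
-- pair of an s and a non-degenerate monotone function arises exactly once.
module Submission where

open import Defs
open import Data.Bool using (Bool; true; false; not; _xor_; _≟_) renaming (_≤_ to _≤ᵇ_)
open import Data.Bool.Properties
  using (≤-antisym; xor-assoc; xor-identityˡ; xor-identityʳ; xor-same; not-distribʳ-xor)
open import Data.Fin using (Fin; zero; suc)
open import Data.Fin.Properties using (injective⇒≤)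
open import Data.List
  using ([]; _∷_; length; filter; lookup; map; cartesianProductWith; cartesianProduct)
open import Data.List.Properties using (length-++; length-map)
open import Data.List.Membership.Setoid.Properties
  using (∈-lookup; ∈-resp-≈; index-injective; ∈-filter⁺; ∈-filter⁻;
         ∈-cartesianProduct⁺; ∈-cartesianProduct⁻)
open import Data.List.Relation.Unary.AllPairs using ([]; _∷_)
open import Data.List.Relation.Unary.Any using (index)
import Data.List.Membership.Setoid as Membership
import Data.List.Relation.Unary.Unique.Setoid as SetoidUnique
import Data.List.Relation.Unary.Unique.Setoid.Properties as SetoidUniqueP
open import Data.Nat using (ℕ; zero; suc; _+_; _*_; _^_; _≤_)
open import Data.Nat.Properties using () renaming (≤-antisym to ≤ℕ-antisym)
open import Data.Product using (_×_; _,_; proj₁; proj₂; assocˡ′; assocʳ′)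
open import Data.Product.Relation.Binary.Pointwise.NonDependent using (_×ₛ_)
open import Data.Sum using (_⊎_; inj₁; inj₂)
open import Data.Unit using (⊤; tt)
open import Data.Vec as Vec using ([]; _∷_; _[_]≔_; replicate; tabulate)
open import Data.Vec.Properties
  using (zipWith-assoc; zipWith-identityˡ; zipWith-identityʳ; []≔-lookup; lookup∘tabulate;
         tabulate∘lookup; tabulate-cong)
open import Function using (id)
open import Level using (Level; 0ℓ)
open import Relation.Binary.Bundles using (Setoid)
open import Relation.Binary.PropositionalEquality
  using (_≡_; refl; sym; trans; cong; cong₂; subst; subst₂; setoid; module ≡-Reasoning)
open import Relation.Nullary using (¬_; Dec; does; yes; no; contradiction)
open import Relation.Unary using (Pred; Decidable; _∩_; _⊆_; _≐_)
open import Relation.Unary.Properties using (_∩?_)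

private
  variable
    a b ℓ₁ ℓ₂ : Level
    n : ℕ

length-cartesianProductWith : ∀ {c} {A : Set a} {B : Set b} {C : Set c} (f : A → B → C) xs ys →
  length (cartesianProductWith f xs ys) ≡ length xs * length ys
length-cartesianProductWith f []       ys = refl
length-cartesianProductWith f (x ∷ xs) ys =
  trans (length-++ (map (f x) ys))
    (cong₂ _+_ (length-map (f x) ys) (length-cartesianProductWith f xs ys))

length-inputs : ∀ n → length (inputs n) ≡ 2 ^ n
length-inputs zero    = refl
length-inputs (suc n) =
  trans (length-cartesianProductWith _∷_ bits (inputs n)) (cong (2 *_) (length-inputs n))

module _ (S : Setoid a ℓ₁) where
  private module S = Setoid S

  lookup-injective : ∀ {xs} → SetoidUnique.Unique S xs →
    ∀ {i j} → lookup xs i S.≈ lookup xs j → i ≡ j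
  lookup-injective (_ ∷ _)      {zero}  {zero}  _ = refl
  lookup-injective u@(_ ∷ _)    {zero}  {suc j} p = contradiction
    (∈-resp-≈ S (S.sym p) (∈-lookup S _ j)) (SetoidUniqueP.Unique[x∷xs]⇒x∉xs S u)
  lookup-injective u@(_ ∷ _)    {suc i} {zero}  p = contradiction
    (∈-resp-≈ S p (∈-lookup S _ i)) (SetoidUniqueP.Unique[x∷xs]⇒x∉xs S u)
  lookup-injective (_ ∷ unique) {suc i} {suc j} p = cong suc (lookup-injective unique p)

module _ (S : Setoid a ℓ₁) (T : Setoid b ℓ₂) where
  private
    module S = Setoid S
    module T = Setoid T
  open Membership S using () renaming (_∈_ to _∈₁_)
  open Membership T using () renaming (_∈_ to _∈₂_)

  injection⇒length≤ : ∀ {xs ys} (f : S.Carrier → T.Carrier) → SetoidUnique.Unique S xs →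
    (∀ {x} → x ∈₁ xs → f x ∈₂ ys) →
    (∀ {x y} → x ∈₁ xs → y ∈₁ xs → f x T.≈ f y → x S.≈ y) →
    length xs ≤ length ys
  injection⇒length≤ {xs} f unique f∈ f-injective =
    injective⇒≤ {f = λ i → index (f∈ (∈-lookup S xs i))} λ {i} {j} eq →
      lookup-injective S unique
        (f-injective (∈-lookup S xs i) (∈-lookup S xs j) (index-injective T _ _ eq))

⊕-cancel : (s x : Input n) → s ⊕ (s ⊕ x) ≡ x
⊕-cancel []      []      = refl
⊕-cancel (b ∷ s) (c ∷ x) =
  cong₂ _∷_ (trans (sym (xor-assoc b b c)) (cong (_xor c) (xor-same b))) (⊕-cancel s x)

⊕-update : (s x : Input n) (i : Fin n) (b : Bool) →
  s ⊕ (x [ i ]≔ b) ≡ (s ⊕ x) [ i ]≔ (Vec.lookup s i xor b)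
⊕-update (c ∷ s) (d ∷ x) zero    b = refl
⊕-update (c ∷ s) (d ∷ x) (suc i) b = cong (_ ∷_) (⊕-update s x i b)

⊕-e : (x : Input n) (i : Fin n) → x ⊕ e i ≡ x [ i ]≔ not (Vec.lookup x i)
⊕-e (false ∷ x) zero    = cong (_ ∷_) (zipWith-identityʳ xor-identityʳ x)
⊕-e (true  ∷ x) zero    = cong (_ ∷_) (zipWith-identityʳ xor-identityʳ x)
⊕-e (b     ∷ x) (suc i) = cong₂ _∷_ (xor-identityʳ b) (⊕-e x i)

infix 4 _≗[_]_

_≗[_]_ : BooleanFunction n → Input n → BooleanFunction n → Set
f ≗[ s ] g = ∀ x → f x ≡ g (s ⊕ x)

translate : Input n → BooleanFunction n → BooleanFunction n
translate s f x = f (s ⊕ x)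

≗-sym : ∀ s (f g : BooleanFunction n) → f ≗[ s ] g → g ≗[ s ] f
≗-sym s f g p x = trans (cong g (sym (⊕-cancel s x))) (sym (p (s ⊕ x)))

translate-≗ : ∀ s (f : BooleanFunction n) → f ≗[ s ] translate s f
translate-≗ s f x = cong f (sym (⊕-cancel s x))

translate-injective : (s : Input n) {f g : BooleanFunction n} →
  (∀ x → translate s f x ≡ translate s g x) → ∀ x → f x ≡ g x
translate-injective s {f} {g} p x =
  trans (cong f (sym (⊕-cancel s x))) (trans (p (s ⊕ x)) (cong g (⊕-cancel s x)))

Invariant : Pred (BooleanFunction n) 0ℓ → Set
Invariant P = ∀ s f g → f ≗[ s ] g → P f → P g

Extensional : Pred (BooleanFunction n) 0ℓ → Set
Extensional P = ∀ {f g} → (∀ x → f x ≡ g x) → P f → P g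

invariant⇒extensional : {P : Pred (BooleanFunction n) 0ℓ} → Invariant P → Extensional P
invariant⇒extensional inv {f} {g} p =
  inv (replicate _ false) f g λ x → trans (p x) (cong g (sym (zipWith-identityˡ xor-identityˡ x)))

∩-invariant : {P Q : Pred (BooleanFunction n) 0ℓ} → Invariant P → Invariant Q → Invariant (P ∩ Q)
∩-invariant invP invQ s f g p (Pf , Qf) = invP s f g p Pf , invQ s f g p Qf

nonDegenerate-invariant : Invariant (NonDegenerate {n})
nonDegenerate-invariant s f g p nd i with nd i
... | α , fα≢ = s ⊕ α , λ eq → fα≢ (begin
    f α                 ≡⟨ p α ⟩
    g (s ⊕ α)           ≡⟨ eq ⟩
    g ((s ⊕ α) ⊕ e i)   ≡⟨ cong g (zipWith-assoc xor-assoc s α (e i)) ⟩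
    g (s ⊕ (α ⊕ e i))   ≡⟨ p (α ⊕ e i) ⟨
    f (α ⊕ e i)         ∎)
  where open ≡-Reasoning

occurrences-≤ : ∀ s (f g : BooleanFunction n) → f ≗[ s ] g → ∀ b → occurrences f b ≤ occurrences g b
occurrences-≤ {n} s f g p b =
  injection⇒length≤ (setoid _) (setoid _) (s ⊕_)
    (SetoidUniqueP.filter⁺ (setoid _) (λ x → f x ≟ b) (inputs-unique n))
    (λ {x} x∈ → ∈-filter⁺ (setoid _) (λ x → g x ≟ b) (λ { refl → id }) (∈-inputs (s ⊕ x))
      (trans (sym (p x)) (proj₂
        (∈-filter⁻ (setoid _) (λ x → f x ≟ b) (λ { refl → id }) {xs = inputs n} x∈))))
    (λ {x} {y} _ _ eq → trans (sym (⊕-cancel s x)) (trans (cong (s ⊕_) eq) (⊕-cancel s y)))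

occurrences-≡ : ∀ s (f g : BooleanFunction n) → f ≗[ s ] g → ∀ b → occurrences f b ≡ occurrences g b
occurrences-≡ s f g p b = ≤ℕ-antisym (occurrences-≤ s f g p b) (occurrences-≤ s g f (≗-sym s f g p) b)

balanced-invariant : Invariant (Balanced {n})
balanced-invariant s f g p bal =
  trans (sym (occurrences-≡ s f g p false)) (trans bal (occurrences-≡ s f g p true))

-- Unfolds to IncreasingIn i for b = false and to DecreasingIn i for b = true.
MonotoneIn : Fin n → Bool → Pred (BooleanFunction n) 0ℓ
MonotoneIn i b f = ∀ x → f (x [ i ]≔ b) ≤ᵇ f (x [ i ]≔ not b)

Oriented : Input n → Pred (BooleanFunction n) 0ℓ
Oriented s f = ∀ i → MonotoneIn i (Vec.lookup s i) f

monotoneIn-translate : ∀ s (f : BooleanFunction n) i b →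
  MonotoneIn i (Vec.lookup s i xor b) f → MonotoneIn i b (translate s f)
monotoneIn-translate s f i b mono x = subst₂ _≤ᵇ_
  (sym (at b))
  (trans (cong (λ c → f ((s ⊕ x) [ i ]≔ c)) (not-distribʳ-xor (Vec.lookup s i) b)) (sym (at (not b))))
  (mono (s ⊕ x))
  where
  at : ∀ c → translate s f (x [ i ]≔ c) ≡ f ((s ⊕ x) [ i ]≔ (Vec.lookup s i xor c))
  at c = cong f (⊕-update s x i c)

oriented⇒monotone : ∀ s (f : BooleanFunction n) → Oriented s f → Monotone (translate s f)
oriented⇒monotone s f or i = monotoneIn-translate s f i false
  (subst (λ b → MonotoneIn i b f) (sym (xor-identityʳ _)) (or i))

monotone⇒oriented : ∀ s (f : BooleanFunction n) → Monotone f → Oriented s (translate s f)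
monotone⇒oriented s f mono i = monotoneIn-translate s f i (Vec.lookup s i)
  (subst (λ b → MonotoneIn i b f) (sym (xor-same (Vec.lookup s i))) (mono i))

oriented⇒unate : ∀ s (f : BooleanFunction n) → Oriented s f → Unate f
oriented⇒unate s f or i with Vec.lookup s i | or i
... | false | inc = inj₁ inc
... | true  | dec = inj₂ dec

oriented-extensional : (s : Input n) → Extensional (Oriented s)
oriented-extensional s p or i x = subst₂ _≤ᵇ_ (p _) (p _) (or i x)

unate-extensional : Extensional (Unate {n})
unate-extensional p un i with un i
... | inj₁ inc = inj₁ λ x → subst₂ _≤ᵇ_ (p _) (p _) (inc x)
... | inj₂ dec = inj₂ λ x → subst₂ _≤ᵇ_ (p _) (p _) (dec x)

monotone-extensional : Extensional (Monotone {n})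
monotone-extensional p mono i x = subst₂ _≤ᵇ_ (p _) (p _) (mono i x)

orientation : BooleanFunction n → Input n
orientation f = tabulate λ i → not (does (increasingIn? i f))

unate⇒oriented : (f : BooleanFunction n) → Unate f → Oriented (orientation f) f
unate⇒oriented f un i =
  subst (λ b → MonotoneIn i b f) (sym (lookup∘tabulate _ i)) (direction (increasingIn? i f) (un i))
  where
  direction : (inc? : Dec (IncreasingIn i f)) → IncreasingIn i f ⊎ DecreasingIn i f →
    MonotoneIn i (not (does inc?)) f
  direction (yes inc) _          = inc
  direction (no _)    (inj₂ dec) = dec
  direction (no ¬inc) (inj₁ inc) = contradiction inc ¬inc

module _ {i : Fin n} {f : BooleanFunction n} where
  monotoneIn-both⇒degenerate : ∀ {b} → MonotoneIn i b f → MonotoneIn i (not b) f → ¬ NonDegenerateOn i f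
  monotoneIn-both⇒degenerate {b} m m′ (α , fα≢) = fα≢ (begin
      f α                                  ≡⟨ cong f ([]≔-lookup α i) ⟨
      f (α [ i ]≔ Vec.lookup α i)          ≡⟨ flip b (Vec.lookup α i) m m′ ⟩
      f (α [ i ]≔ not (Vec.lookup α i))    ≡⟨ cong f (⊕-e α i) ⟨
      f (α ⊕ e i)                          ∎)
    where
    open ≡-Reasoning
    flip : ∀ b c → MonotoneIn i b f → MonotoneIn i (not b) f → f (α [ i ]≔ c) ≡ f (α [ i ]≔ not c)
    flip false false m m′ = ≤-antisym (m α) (m′ α)
    flip false true  m m′ = ≤-antisym (m′ α) (m α)
    flip true  false m m′ = ≤-antisym (m′ α) (m α)
    flip true  true  m m′ = ≤-antisym (m α) (m′ α)

  monotoneIn-unique : NonDegenerateOn i f → ∀ {b c} → MonotoneIn i b f → MonotoneIn i c f → b ≡ c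
  monotoneIn-unique nd {false} {false} m m′ = refl
  monotoneIn-unique nd {true}  {true}  m m′ = refl
  monotoneIn-unique nd {false} {true}  m m′ = contradiction nd (monotoneIn-both⇒degenerate m m′)
  monotoneIn-unique nd {true}  {false} m m′ = contradiction nd (monotoneIn-both⇒degenerate m m′)

orientation-unique : (f : BooleanFunction n) → NonDegenerate f →
  ∀ s t → Oriented s f → Oriented t f → s ≡ t
orientation-unique f nd s t or or′ = begin
  s                       ≡⟨ tabulate∘lookup s ⟨
  tabulate (Vec.lookup s) ≡⟨ tabulate-cong (λ i → monotoneIn-unique (nd i) (or i) (or′ i)) ⟩
  tabulate (Vec.lookup t) ≡⟨ tabulate∘lookup t ⟩
  t                       ∎
  where open ≡-Reasoning

module _ {P Q : Pred (BooleanFunction n) 0ℓ} (P? : Decidable P) (Q? : Decidable Q)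
  (P-ext : Extensional P) (Q-ext : Extensional Q) where

  private
    I = setoid (Input n)
    F = functionSetoid n
    xs = filter P? (functions n)
    ys = filter Q? (functions n)

    length-pairs : length (cartesianProduct (inputs n) ys) ≡ 2 ^ n * count Q Q?
    length-pairs = trans (length-cartesianProductWith _,_ (inputs n) ys)
      (cong (_* length ys) (length-inputs n))

    ∈xs⇒P : ∀ {f} → Membership._∈_ F f xs → P f
    ∈xs⇒P f∈ = proj₂ (∈-filter⁻ F P? P-ext {xs = functions n} f∈)

  count-≤ : (s : BooleanFunction n → Input n) → (∀ {f} → P f → Q (translate (s f) f)) →
    count P P? ≤ 2 ^ n * count Q Q?
  count-≤ s P⇒Q = subst (count P P? ≤_) length-pairs
    (injection⇒length≤ F (I ×ₛ F) (λ f → s f , translate (s f) f)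
      (SetoidUniqueP.filter⁺ F P? (functions-unique n))
      (λ {f} f∈ → ∈-cartesianProduct⁺ I F (∈-inputs (s f))
        (∈-filter⁺ F Q? Q-ext (functions-enumerates n _) (P⇒Q (∈xs⇒P f∈))))
      (λ {f} {g} _ _ (s≡ , p) → translate-injective (s f) λ x →
        trans (p x) (cong (λ t → g (t ⊕ x)) (sym s≡))))

  count-≥ : (∀ s {f} → Q f → P (translate s f)) →
    (∀ {s t f g} → Q f → Q g → (∀ x → translate s f x ≡ translate t g x) → s ≡ t) →
    2 ^ n * count Q Q? ≤ count P P?
  count-≥ Q⇒P unique = subst (_≤ count P P?) length-pairs
    (injection⇒length≤ (I ×ₛ F) F (λ (s , f) → translate s f)
      (SetoidUniqueP.cartesianProduct⁺ I F (inputs-unique n)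
        (SetoidUniqueP.filter⁺ F Q? (functions-unique n)))
      (λ {(s , f)} sf∈ → ∈-filter⁺ F P? P-ext (functions-enumerates n _) (Q⇒P s (∈⇒Q sf∈)))
      λ {(s , f)} {(t , g)} sf∈ tg∈ p → let s≡t = unique (∈⇒Q sf∈) (∈⇒Q tg∈) p in
        s≡t , translate-injective s λ x → trans (p x) (cong (λ t → g (t ⊕ x)) (sym s≡t)))
    where
    ∈⇒Q : ∀ {s f} → Membership._∈_ (I ×ₛ F) (s , f) (cartesianProduct (inputs n) ys) → Q f
    ∈⇒Q sf∈ = proj₂ (∈-filter⁻ F Q? Q-ext {xs = functions n}
      (proj₂ (∈-cartesianProduct⁻ I F (inputs n) ys sf∈)))

module _ {R P Q : Pred (BooleanFunction n) 0ℓ} (R-inv : Invariant R)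
  (P? : Decidable P) (P≐ : P ≐ R ∩ Unate) (Q? : Decidable Q) (Q≐ : Q ≐ R ∩ Monotone) where

  private
    P-ext : Extensional P
    P-ext {f} {g} p Pf = let Rf , un = proj₁ P≐ Pf in
      proj₂ P≐ (invariant⇒extensional R-inv p Rf , unate-extensional {_} {f} {g} p un)

    Q-ext : Extensional Q
    Q-ext {f} {g} p Qf = let Rf , mono = proj₁ Q≐ Qf in
      proj₂ Q≐ (invariant⇒extensional R-inv p Rf , monotone-extensional {_} {f} {g} p mono)

    R-translate : ∀ s {f} → R f → R (translate s f)
    R-translate s {f} = R-inv s f (translate s f) (translate-≗ s f)

  unate-≤ : count P P? ≤ 2 ^ n * count Q Q?
  unate-≤ = count-≤ P? Q? P-ext Q-ext orientation λ {f} Pf →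
    let Rf , un = proj₁ P≐ Pf
        s       = orientation f
    in proj₂ Q≐ (R-translate s Rf , oriented⇒monotone s f (unate⇒oriented f un))

  unate-≡ : R ⊆ NonDegenerate → count P P? ≡ 2 ^ n * count Q Q?
  unate-≡ R⊆ND = ≤ℕ-antisym unate-≤ (count-≥ P? Q? P-ext Q-ext
    (λ s {f} Qf →
      let Rf , mono = proj₁ Q≐ Qf
      in proj₂ P≐ (R-translate s Rf , oriented⇒unate s (translate s f) (monotone⇒oriented s f mono)))
    λ {s} {t} {f} {g} Qf Qg p →
      let Rf , f-mono = proj₁ Q≐ Qf
          _  , g-mono = proj₁ Q≐ Qg
      in orientation-unique (translate s f) (R⊆ND (R-translate s Rf)) s t
           (monotone⇒oriented s f f-mono)
           (oriented-extensional t {translate t g} (λ x → sym (p x)) (monotone⇒oriented t g g-mono)))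

proposition2 : ∀ (n : ℕ) →
    (nd-U n ≡ 2 ^ n * nd-M n) ×
    (nd-BU n ≡ 2 ^ n * nd-BM n) ×
    (U n ≤ 2 ^ n * M n) ×
    (BU n ≤ 2 ^ n * BM n)
proposition2 n =
  unate-≡ {n} nonDegenerate-invariant
    (nonDegenerate? ∩? unate?) (id , id) (nonDegenerate? ∩? monotone?) (id , id) id ,
  unate-≡ {n} (∩-invariant nonDegenerate-invariant balanced-invariant)
    (nonDegenerate? ∩? (balanced? ∩? unate?)) (assocˡ′ , assocʳ′)
    (nonDegenerate? ∩? (balanced? ∩? monotone?)) (assocˡ′ , assocʳ′) proj₁ ,
  unate-≤ {n} {R = λ _ → ⊤} (λ _ _ _ _ _ → tt) unate? ((tt ,_) , proj₂) monotone? ((tt ,_) , proj₂) ,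
  unate-≤ {n} balanced-invariant
    (balanced? ∩? unate?) (id , id) (balanced? ∩? monotone?) (id , id)
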